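{- Let $C_n=\frac1{n+1}\binom{2n}n$ be the $n$-th Catalan number. Then, as Laurent series in $z$, $$\sum_{n\ge0}C_nz^n=-13z^{ -1}-3\left(4+2z^{ -1}\right)\Psi(-z)+\left(-8z-14+4z^{ -1}\right)\Psi^3(-z)+3\left(z^2-6z+9-4z^{ -1}\right)\Psi^5(-z)\quad\text{modulo }27.$$
   Context: $\Psi(z)=\prod_{j\ge0}(1+z^{3^j})$, so $\Psi(-z)=\prod_{j\ge0}(1-z^{3^j})$. "Modulo $27$" means coefficientwise congruence of Laurent series in $z$. -}

module Defs where

open import Data.Bool.Base using (if_then_else_)
open import Data.Fin.Base using (toℕ)
open import Data.Integer.Base as ℤ using (ℤ; +_; -[1+_]; 0ℤ; 1ℤ; -1ℤ)
import Data.Integer.Divisibility.Signed as ℤ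
import Data.Integer.Properties as ℤ
open import Data.Nat.Base as ℕ using (ℕ; zero; suc; _≤_; _<_; z≤n; s≤s; _≡ᵇ_)
open import Data.Nat.Combinatorics
  using (_C_; k>n⇒nCk≡0; nC1≡n; nCk+nC[k+1]≡[n+1]C[k+1])
open import Data.Nat.Divisibility using (divides-refl; ∣m+n∣m⇒∣n)
  renaming (_∣_ to _ℕ∣_)
open import Data.Nat.DivMod using (_/_; m*[n/m]≡n)
import Data.Nat.Properties as ℕ
open import Data.Nat.Tactic.RingSolver using (solve-∀)
open import Relation.Binary.PropositionalEquality
open import Algebra.Properties.Semiring.Sum ℤ.+-*-semiring using (sum)

infix  4 _≡_[mod_]
infixl 6 _+_ _-_ _+ₚ_
infixl 7 _*_ _*ₚ_
infix  8 -_
infixr 9 _^_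
infix  10 #_ _⟨-z⟩

------------------------------------------------------------------------
-- Formal power series over ℤ, given by their coefficients

PowerSeries : Set
PowerSeries = ℕ → ℤ

zₚ^_ : ℕ → PowerSeries
(zₚ^ d) n = if n ≡ᵇ d then 1ℤ else 0ℤ

_+ₚ_ : PowerSeries → PowerSeries → PowerSeries
(f +ₚ g) n = f n ℤ.+ g n

_*ₚ_ : PowerSeries → PowerSeries → PowerSeries
(f *ₚ g) n = sum {suc n} λ i → f (toℕ i) ℤ.* g (n ℕ.∸ toℕ i)

-- The substitution z ↦ -z.
_⟨-z⟩ : PowerSeries → PowerSeries
(f ⟨-z⟩) n = -1ℤ ℤ.^ n ℤ.* f n

------------------------------------------------------------------------
-- The infinite product Ψ(z) = ∏_{j ≥ 0} (1 + z^(3^j))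

-- Ψ-partial m is the product of the factors with j < m.
Ψ-partial : ℕ → PowerSeries
Ψ-partial zero    = zₚ^ 0
Ψ-partial (suc m) = Ψ-partial m *ₚ (zₚ^ 0 +ₚ zₚ^ (3 ℕ.^ m))

-- The factors with j ≥ n do not affect the coefficient of zⁿ, since n < 3^n;
-- Ψ-limit shows that this is the coefficientwise limit of the partial products.
Ψ : PowerSeries
Ψ n = Ψ-partial n n

private
  n<3^n : ∀ n → n < 3 ℕ.^ n
  n<3^n zero    = s≤s z≤n
  n<3^n (suc n) = ℕ.≤-trans (s≤s (n<3^n n))
    (ℕ.≤-trans (ℕ.+-monoˡ-≤ (3 ℕ.^ n) (ℕ.m^n>0 3 n))
      (ℕ.+-monoʳ-≤ (3 ℕ.^ n) (ℕ.m≤m+n (3 ℕ.^ n) _)))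

  zₚ-below : ∀ {n d} → n < d → (zₚ^ d) n ≡ 0ℤ
  zₚ-below {zero}  (s≤s _) = refl
  zₚ-below {suc n} (s≤s p) = zₚ-below p

  *ₚ-1+ : ∀ f {n d} → n < d → (f *ₚ (zₚ^ 0 +ₚ zₚ^ d)) n ≡ f n
  *ₚ-1+ f {zero}  {suc d} _ = trans (ℤ.+-identityʳ _) (ℤ.*-identityʳ (f 0))
  *ₚ-1+ f {suc n} {d}     p = trans
    (cong₂ ℤ._+_
      (trans (cong (λ c → f 0 ℤ.* (0ℤ ℤ.+ c)) (zₚ-below p)) (ℤ.*-zeroʳ (f 0)))
      (*ₚ-1+ (λ k → f (suc k)) (ℕ.<-trans (ℕ.n<1+n n) p)))
    (ℤ.+-identityˡ _)

  Ψ-limit′ : ∀ n k → Ψ-partial (k ℕ.+ n) n ≡ Ψ n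
  Ψ-limit′ n zero    = refl
  Ψ-limit′ n (suc k) = trans
    (*ₚ-1+ (Ψ-partial (k ℕ.+ n))
      (ℕ.<-≤-trans (n<3^n n) (ℕ.^-monoʳ-≤ 3 (ℕ.m≤n+m n k))))
    (Ψ-limit′ n k)

Ψ-limit : ∀ {n m} → n ≤ m → Ψ-partial m n ≡ Ψ n
Ψ-limit {n} {m} p =
  subst (λ l → Ψ-partial l n ≡ Ψ n) (ℕ.m∸n+n≡m p) (Ψ-limit′ n (m ℕ.∸ n))

------------------------------------------------------------------------
-- Formal Laurent series over ℤ

-- z^-⟨ p ⟩· f stands for z^(-p) f(z).  The representation is not unique, so
-- Laurent series are only ever compared through their coefficients.
infix 5 z^-⟨_⟩·_
record Laurent : Set where
  constructor z^-⟨_⟩·_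
  field
    pole   : ℕ
    series : PowerSeries

coeff : Laurent → ℤ → ℤ
coeff (z^-⟨ p ⟩· f) k with k ℤ.+ + p
... | + n      = f n
... | -[1+ _ ] = 0ℤ

fromPS : PowerSeries → Laurent
fromPS f = z^-⟨ 0 ⟩· f

#_ : ℕ → Laurent
# c = fromPS λ { zero → + c ; (suc _) → 0ℤ }

z z⁻¹ : Laurent
z   = fromPS (zₚ^ 1)
z⁻¹ = z^-⟨ 1 ⟩· zₚ^ 0

-- z^(-p) f + z^(-q) g = z^(-(p+q)) (z^q f + z^p g)
_+_ : Laurent → Laurent → Laurent
(z^-⟨ p ⟩· f) + (z^-⟨ q ⟩· g) =
  z^-⟨ p ℕ.+ q ⟩· (zₚ^ q *ₚ f +ₚ zₚ^ p *ₚ g)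

_*_ : Laurent → Laurent → Laurent
(z^-⟨ p ⟩· f) * (z^-⟨ q ⟩· g) = z^-⟨ p ℕ.+ q ⟩· f *ₚ g

-_ : Laurent → Laurent
- (z^-⟨ p ⟩· f) = z^-⟨ p ⟩· λ n → ℤ.- f n

_-_ : Laurent → Laurent → Laurent
a - b = a + (- b)

_^_ : Laurent → ℕ → Laurent
a ^ zero  = # 1
a ^ suc n = a * a ^ n

_≡_[mod_] : Laurent → Laurent → ℕ → Set
a ≡ b [mod m ] = ∀ (k : ℤ) → + m ℤ.∣ coeff a k ℤ.- coeff b k

Ψ[-z] : Laurent
Ψ[-z] = fromPS (Ψ ⟨-z⟩)

------------------------------------------------------------------------
-- Catalan numbers

-- The division is exact, by catalan-exact.
catalan : ℕ → ℕ
catalan n = ((2 ℕ.* n) C n) / suc n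

private
  absorption : ∀ n k → suc k ℕ.* (suc n C suc k) ≡ suc n ℕ.* (n C k)
  absorption zero    zero    = refl
  absorption zero    (suc k) = trans
    (cong (suc (suc k) ℕ.*_) (k>n⇒nCk≡0 {1} {suc (suc k)} (s≤s (s≤s z≤n))))
    (trans (ℕ.*-zeroʳ k)
      (cong (1 ℕ.*_) (sym (k>n⇒nCk≡0 {0} {suc k} (s≤s z≤n)))))
  absorption (suc m) zero    = trans (ℕ.*-identityˡ _)
    (trans (nC1≡n (suc (suc m))) (sym (ℕ.*-identityʳ _)))
  absorption (suc m) (suc j) = begin
    suc k ℕ.* (suc (suc m) C suc k)
      ≡⟨ cong (suc k ℕ.*_) (nCk+nC[k+1]≡[n+1]C[k+1] (suc m) k) ⟨
    suc k ℕ.* (a ℕ.+ b)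
      ≡⟨ expand k a b ⟩
    a ℕ.+ (k ℕ.* a ℕ.+ suc k ℕ.* b)
      ≡⟨ cong (a ℕ.+_) (cong₂ ℕ._+_ (absorption m j) (absorption m k)) ⟩
    a ℕ.+ (suc m ℕ.* (m C j) ℕ.+ suc m ℕ.* (m C k))
      ≡⟨ cong (a ℕ.+_) (ℕ.*-distribˡ-+ (suc m) (m C j) (m C k)) ⟨
    a ℕ.+ suc m ℕ.* ((m C j) ℕ.+ (m C k))
      ≡⟨ cong (λ c → a ℕ.+ suc m ℕ.* c) (nCk+nC[k+1]≡[n+1]C[k+1] m j) ⟩
    suc (suc m) ℕ.* a ∎
    where
    open ≡-Reasoning
    k = suc j
    a = suc m C k
    b = suc m C suc k
    expand : ∀ k a b → suc k ℕ.* (a ℕ.+ b) ≡ a ℕ.+ (k ℕ.* a ℕ.+ suc k ℕ.* b)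
    expand = solve-∀

  suc∣centralBinomial : ∀ n → suc n ℕ∣ (2 ℕ.* n) C n
  suc∣centralBinomial n = ∣m+n∣m⇒∣n
    (subst (suc n ℕ∣_) (regroup n c) (divides-refl (2 ℕ.* c)))
    (subst (suc n ℕ∣_)
      (trans (ℕ.*-comm _ (suc n)) (absorption (2 ℕ.* n) n))
      (divides-refl (suc (2 ℕ.* n) C suc n)))
    where
    c = (2 ℕ.* n) C n
    regroup : ∀ n c → 2 ℕ.* c ℕ.* suc n ≡ suc (2 ℕ.* n) ℕ.* c ℕ.+ c
    regroup = solve-∀

catalan-exact : ∀ n → suc n ℕ.* catalan n ≡ (2 ℕ.* n) C n
catalan-exact n = m*[n/m]≡n (suc∣centralBinomial n)

∑Cₙzⁿ : Laurent
∑Cₙzⁿ = fromPS λ n → + catalan n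

{-# OPTIONS --safe #-}
module Submission where

-- With T = z C(z), the recursion (n + 2) C_{n+1} = (4 n + 2) C_n is a linear
-- differential equation for T, and it forces T² − T + z = 0.  On the other hand
-- (1 + x)² (1 + x) ≡ 1 + x³ modulo 3 telescopes to (1 + z) Ψ(z)² ≡ 1, hence
-- (1 − z) P² = 1 + 3 h for P = Ψ(−z).  If G is z times the right-hand side, then
-- G = −13 + P A(z, P²), so G² − G + z ≡ 182 + z + P² A(z, P²)² modulo 27 involves
-- only P², and multiplied by (1 − z)³ it becomes a polynomial in z and h all of
-- whose coefficients are divisible by 27.  Thus (G − T) (G + T − 1) (1 − z)³ ≡ 0,
-- and the last two factors have the constant term −28, a unit modulo 27.

open import Defs

open import Algebra.Bundles using (CommutativeRing)
open import Algebra.Solver.Ring.AlmostCommutativeRing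
  using (fromCommutativeRing; _-Raw-AlmostCommutative⟶_; Induced-equivalence)
import Algebra.Solver.Ring as RingSolver
open import Data.Integer.Base as ℤ using (ℤ; +_; -[1+_]; 0ℤ; 1ℤ; -1ℤ)
open import Data.Integer.Coprimality using (Coprime; coprime?; coprime-divisor)
open import Data.Integer.Divisibility.Signed as ℤ using (_∣_; divides)
import Data.Integer.Properties as ℤ
import Data.Integer.Tactic.RingSolver as ℤ-Solver
import Data.Maybe.Base as Maybe
open import Data.Nat.Base as ℕ using (ℕ; zero; suc; _≤_; _<_; z≤n; s≤s; _!)
open import Data.Nat.Combinatorics using (_C_; nCk≡n!/k![n-k]!; k![n∸k]!∣n!)
open import Data.Nat.DivMod using (_/_; m/n*n≡m)
import Data.Nat.Properties as ℕ
open import Data.Nat.Properties using (_!*_!≢0)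
import Data.Nat.Tactic.RingSolver as ℕ-Solver
open import Data.Product.Base using (_,_)
open import Level using (0ℓ)
open import Relation.Binary.Definitions using (WeaklyDecidable)
open import Relation.Binary.PropositionalEquality
  using (_≡_; refl; sym; trans; cong; cong₂; subst; subst₂; module ≡-Reasoning)
open import Relation.Nullary.Decidable.Core using (dec⇒maybe; from-yes)

-- Cauchy products

-- The recursion (f g)(n+1) = f(0) g(n+1) + (tail f · g)(n), on which the
-- inductions below rest, holds by computation.
tail : PowerSeries → PowerSeries
tail f n = f (suc n)

-ₚ_ : PowerSeries → PowerSeries
(-ₚ f) n = ℤ.- f n

*ₚ-congˡ : ∀ {f f′} g → (∀ n → f n ≡ f′ n) → ∀ n → (f *ₚ g) n ≡ (f′ *ₚ g) n
*ₚ-congˡ g p zero    = cong (λ a → a ℤ.* g 0 ℤ.+ 0ℤ) (p 0)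
*ₚ-congˡ g p (suc n) =
  cong₂ ℤ._+_ (cong (ℤ._* g (suc n)) (p 0)) (*ₚ-congˡ g (λ k → p (suc k)) n)

*ₚ-zeroˡ : ∀ {f} g → (∀ n → f n ≡ 0ℤ) → ∀ n → (f *ₚ g) n ≡ 0ℤ
*ₚ-zeroˡ g p zero    = cong (λ a → a ℤ.* g 0 ℤ.+ 0ℤ) (p 0)
*ₚ-zeroˡ g p (suc n) =
  cong₂ ℤ._+_ (cong (ℤ._* g (suc n)) (p 0)) (*ₚ-zeroˡ g (λ k → p (suc k)) n)

*ₚ-distribʳ : ∀ f g h n → ((f +ₚ g) *ₚ h) n ≡ (f *ₚ h) n ℤ.+ (g *ₚ h) n
*ₚ-distribʳ f g h zero = lemma (f 0) (g 0) (h 0)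
  where
  lemma : ∀ a b c →
    (a ℤ.+ b) ℤ.* c ℤ.+ 0ℤ ≡ (a ℤ.* c ℤ.+ 0ℤ) ℤ.+ (b ℤ.* c ℤ.+ 0ℤ)
  lemma = ℤ-Solver.solve-∀
*ₚ-distribʳ f g h (suc n) = trans
  (cong (ℤ._+_ ((f 0 ℤ.+ g 0) ℤ.* h (suc n))) (*ₚ-distribʳ (tail f) (tail g) h n))
  (lemma (f 0) (g 0) (h (suc n)) _ _)
  where
  lemma : ∀ a b c x y →
    (a ℤ.+ b) ℤ.* c ℤ.+ (x ℤ.+ y) ≡ (a ℤ.* c ℤ.+ x) ℤ.+ (b ℤ.* c ℤ.+ y)
  lemma = ℤ-Solver.solve-∀

*ₚ-scaleˡ : ∀ c f g n → ((λ i → c ℤ.* f i) *ₚ g) n ≡ c ℤ.* (f *ₚ g) n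
*ₚ-scaleˡ c f g zero = lemma c (f 0) (g 0)
  where
  lemma : ∀ c a b → c ℤ.* a ℤ.* b ℤ.+ 0ℤ ≡ c ℤ.* (a ℤ.* b ℤ.+ 0ℤ)
  lemma = ℤ-Solver.solve-∀
*ₚ-scaleˡ c f g (suc n) = trans
  (cong (ℤ._+_ (c ℤ.* f 0 ℤ.* g (suc n))) (*ₚ-scaleˡ c (tail f) g n))
  (lemma c (f 0) (g (suc n)) _)
  where
  lemma : ∀ c a b x → c ℤ.* a ℤ.* b ℤ.+ c ℤ.* x ≡ c ℤ.* (a ℤ.* b ℤ.+ x)
  lemma = ℤ-Solver.solve-∀

-- The mirror image of the defining recursion: the last summand is split off instead of the first.
-- Playing the two recursions against each other gives commutativity.
*ₚ-sucʳ : ∀ f g n → (f *ₚ g) (suc n) ≡ f (suc n) ℤ.* g 0 ℤ.+ (f *ₚ tail g) n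
*ₚ-sucʳ f g zero = lemma (f 0 ℤ.* g 1) (f 1 ℤ.* g 0)
  where
  lemma : ∀ a b → a ℤ.+ (b ℤ.+ 0ℤ) ≡ b ℤ.+ (a ℤ.+ 0ℤ)
  lemma = ℤ-Solver.solve-∀
*ₚ-sucʳ f g (suc n) = trans
  (cong (ℤ._+_ (f 0 ℤ.* g (suc (suc n)))) (*ₚ-sucʳ (tail f) g n))
  (lemma (f 0 ℤ.* g (suc (suc n))) (f (suc (suc n)) ℤ.* g 0) _)
  where
  lemma : ∀ a b c → a ℤ.+ (b ℤ.+ c) ≡ b ℤ.+ (a ℤ.+ c)
  lemma = ℤ-Solver.solve-∀

*ₚ-comm : ∀ f g n → (f *ₚ g) n ≡ (g *ₚ f) n
*ₚ-comm f g zero    = cong (ℤ._+ 0ℤ) (ℤ.*-comm (f 0) (g 0))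
*ₚ-comm f g (suc n) = trans
  (cong₂ ℤ._+_ (ℤ.*-comm (f 0) (g (suc n))) (*ₚ-comm (tail f) g n))
  (sym (*ₚ-sucʳ g f n))

-- By computation `tail (f *ₚ g)` is f(0) · `tail g` + `tail f *ₚ g`, so linearity in the left
-- factor reduces the claim to `tail f`.
*ₚ-assoc : ∀ f g h n → ((f *ₚ g) *ₚ h) n ≡ (f *ₚ (g *ₚ h)) n
*ₚ-assoc f g h zero = lemma (f 0) (g 0) (h 0)
  where
  lemma : ∀ a b c →
    (a ℤ.* b ℤ.+ 0ℤ) ℤ.* c ℤ.+ 0ℤ ≡ a ℤ.* (b ℤ.* c ℤ.+ 0ℤ) ℤ.+ 0ℤ
  lemma = ℤ-Solver.solve-∀
*ₚ-assoc f g h (suc n) = begin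
  fg₀ ℤ.* h (suc n) ℤ.+ (((λ i → f 0 ℤ.* g (suc i)) +ₚ (tail f *ₚ g)) *ₚ h) n
    ≡⟨ cong (ℤ._+_ (fg₀ ℤ.* h (suc n)))
         (*ₚ-distribʳ (λ i → f 0 ℤ.* g (suc i)) (tail f *ₚ g) h n) ⟩
  fg₀ ℤ.* h (suc n) ℤ.+
    (((λ i → f 0 ℤ.* g (suc i)) *ₚ h) n ℤ.+ ((tail f *ₚ g) *ₚ h) n)
    ≡⟨ cong (ℤ._+_ (fg₀ ℤ.* h (suc n)))
         (cong₂ ℤ._+_ (*ₚ-scaleˡ (f 0) (tail g) h n) (*ₚ-assoc (tail f) g h n)) ⟩
  fg₀ ℤ.* h (suc n) ℤ.+
    (f 0 ℤ.* (tail g *ₚ h) n ℤ.+ (tail f *ₚ (g *ₚ h)) n)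
    ≡⟨ lemma (f 0) (g 0) (h (suc n)) _ _ ⟩
  f 0 ℤ.* (g 0 ℤ.* h (suc n) ℤ.+ (tail g *ₚ h) n) ℤ.+ (tail f *ₚ (g *ₚ h)) n ∎
  where
  open ≡-Reasoning
  fg₀ = f 0 ℤ.* g 0 ℤ.+ 0ℤ
  lemma : ∀ a b c x y →
    (a ℤ.* b ℤ.+ 0ℤ) ℤ.* c ℤ.+ (a ℤ.* x ℤ.+ y) ≡ a ℤ.* (b ℤ.* c ℤ.+ x) ℤ.+ y
  lemma = ℤ-Solver.solve-∀

*ₚ-identityˡ : ∀ f n → (zₚ^ 0 *ₚ f) n ≡ f n
*ₚ-identityˡ f zero    = trans (ℤ.+-identityʳ _) (ℤ.*-identityˡ (f 0))
*ₚ-identityˡ f (suc n) = trans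
  (cong₂ ℤ._+_ (ℤ.*-identityˡ (f (suc n))) (*ₚ-zeroˡ f (λ _ → refl) n))
  (ℤ.+-identityʳ _)

*ₚ-distribˡ : ∀ f g h n → (f *ₚ (g +ₚ h)) n ≡ (f *ₚ g) n ℤ.+ (f *ₚ h) n
*ₚ-distribˡ f g h n = trans (*ₚ-comm f (g +ₚ h) n) (trans (*ₚ-distribʳ g h f n)
  (cong₂ ℤ._+_ (*ₚ-comm g f n) (*ₚ-comm h f n)))

-- Monomials and constants

zₚ-* : ∀ d e n → (zₚ^ d *ₚ zₚ^ e) n ≡ (zₚ^ (d ℕ.+ e)) n
zₚ-* zero    e n       = *ₚ-identityˡ (zₚ^ e) n
zₚ-* (suc d) e zero    = refl
zₚ-* (suc d) e (suc n) = trans (ℤ.+-identityˡ _) (zₚ-* d e n)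

zₚ-shift : ∀ d f n → (zₚ^ d *ₚ f) (d ℕ.+ n) ≡ f n
zₚ-shift zero    f n = *ₚ-identityˡ f n
zₚ-shift (suc d) f n = trans (ℤ.+-identityˡ _) (zₚ-shift d f n)

zₚ-*-below : ∀ {d n} f → n < d → (zₚ^ d *ₚ f) n ≡ 0ℤ
zₚ-*-below {n = zero}  f (s≤s _) = refl
zₚ-*-below {n = suc n} f (s≤s p) = trans (ℤ.+-identityˡ _) (zₚ-*-below f p)

zₚ-below : ∀ {d n} → n < d → (zₚ^ d) n ≡ 0ℤ
zₚ-below {n = zero}  (s≤s _) = refl
zₚ-below {n = suc n} (s≤s p) = zₚ-below p

-- On naturals κ c is the series of # c by computation, so that the solver's
-- constants are the literals of the theorem.
κ : ℤ → PowerSeries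
κ (+ c)    = Laurent.series (# c)
κ -[1+ c ] = -ₚ Laurent.series (# suc c)

κ-0 : ∀ c → κ c 0 ≡ c
κ-0 (+ c)    = refl
κ-0 -[1+ c ] = refl

κ-suc : ∀ c n → κ c (suc n) ≡ 0ℤ
κ-suc (+ c)    n = refl
κ-suc -[1+ c ] n = refl

κ-* : ∀ c f n → (κ c *ₚ f) n ≡ c ℤ.* f n
κ-* c f zero    = trans (ℤ.+-identityʳ _) (cong (ℤ._* f 0) (κ-0 c))
κ-* c f (suc n) = trans
  (cong₂ ℤ._+_ (cong (ℤ._* f (suc n)) (κ-0 c)) (*ₚ-zeroˡ f (κ-suc c) n))
  (ℤ.+-identityʳ _)

-- Power series modulo m; m = 0 gives the series over ℤ themselves

module Mod (m : ℕ) where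

  infix 4 _∼_ _≈_ _≃_

  -- A record keeps a and b inferable from the type; the difference a - b alone does not determine
  -- them.
  record _∼_ (a b : ℤ) : Set where
    constructor difference
    field m∣a-b : + m ∣ a ℤ.- b

  ∼-reflexive : ∀ {a b} → a ≡ b → a ∼ b
  ∼-reflexive {a} refl = difference (divides 0ℤ (ℤ.+-inverseʳ a))

  ∼-refl : ∀ {a} → a ∼ a
  ∼-refl = ∼-reflexive refl

  ∼-sym : ∀ {a b} → a ∼ b → b ∼ a
  ∼-sym {a} {b} (difference p) =
    difference (subst (+ m ∣_) (lemma a b) (ℤ.∣m⇒∣-m p))
    where
    lemma : ∀ a b → ℤ.- (a ℤ.- b) ≡ b ℤ.- a
    lemma = ℤ-Solver.solve-∀

  ∼-trans : ∀ {a b c} → a ∼ b → b ∼ c → a ∼ c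
  ∼-trans {a} {b} {c} (difference p) (difference q) =
    difference (subst (+ m ∣_) (lemma a b c) (ℤ.∣m∣n⇒∣m+n p q))
    where
    lemma : ∀ a b c → (a ℤ.- b) ℤ.+ (b ℤ.- c) ≡ a ℤ.- c
    lemma = ℤ-Solver.solve-∀

  ∼-+-cong : ∀ {a b c d} → a ∼ b → c ∼ d → a ℤ.+ c ∼ b ℤ.+ d
  ∼-+-cong {a} {b} {c} {d} (difference p) (difference q) =
    difference (subst (+ m ∣_) (lemma a b c d) (ℤ.∣m∣n⇒∣m+n p q))
    where
    lemma : ∀ a b c d → (a ℤ.- b) ℤ.+ (c ℤ.- d) ≡ (a ℤ.+ c) ℤ.- (b ℤ.+ d)
    lemma = ℤ-Solver.solve-∀

  ∼-*-cong : ∀ {a b c d} → a ∼ b → c ∼ d → a ℤ.* c ∼ b ℤ.* d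
  ∼-*-cong {a} {b} {c} {d} (difference p) (difference q) =
    difference (subst (+ m ∣_) (lemma a b c d)
      (ℤ.∣m∣n⇒∣m+n (ℤ.∣m⇒∣m*n c p) (ℤ.∣n⇒∣m*n b q)))
    where
    lemma : ∀ a b c d →
      (a ℤ.- b) ℤ.* c ℤ.+ b ℤ.* (c ℤ.- d) ≡ a ℤ.* c ℤ.- b ℤ.* d
    lemma = ℤ-Solver.solve-∀

  ∼-neg-cong : ∀ {a b} → a ∼ b → ℤ.- a ∼ ℤ.- b
  ∼-neg-cong {a} {b} (difference p) =
    difference (subst (+ m ∣_) (lemma a b) (ℤ.∣m⇒∣-m p))
    where
    lemma : ∀ a b → ℤ.- (a ℤ.- b) ≡ ℤ.- a ℤ.- ℤ.- b
    lemma = ℤ-Solver.solve-∀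

  ∼0⇒∣ : ∀ {a} → a ∼ 0ℤ → + m ∣ a
  ∼0⇒∣ {a} (difference p) = subst (+ m ∣_) (ℤ.+-identityʳ a) p

  record _≈_ (f g : PowerSeries) : Set where
    constructor pointwise
    field at : ∀ n → f n ∼ g n
  open _≈_ public

  ≗⇒≈ : ∀ {f g} → (∀ n → f n ≡ g n) → f ≈ g
  ≗⇒≈ p = pointwise λ n → ∼-reflexive (p n)

  -- A Cauchy product looks no further than degree n. The bound matters for Ψ, which agrees with a
  -- given partial product only up to some degree.
  *ₚ-cong-≤ : ∀ f f′ g g′ n →
    (∀ i → i ≤ n → f i ∼ f′ i) → (∀ i → i ≤ n → g i ∼ g′ i) →
    (f *ₚ g) n ∼ (f′ *ₚ g′) n
  *ₚ-cong-≤ f f′ g g′ zero    p q =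
    ∼-+-cong (∼-*-cong (p 0 z≤n) (q 0 z≤n)) (∼-refl {0ℤ})
  *ₚ-cong-≤ f f′ g g′ (suc n) p q = ∼-+-cong
    (∼-*-cong (p 0 z≤n) (q (suc n) ℕ.≤-refl))
    (*ₚ-cong-≤ (tail f) (tail f′) g g′ n
      (λ i i≤n → p (suc i) (s≤s i≤n)) (λ i i≤n → q i (ℕ.m≤n⇒m≤1+n i≤n)))

  commutativeRing : CommutativeRing 0ℓ 0ℓ
  commutativeRing = record
    { Carrier = PowerSeries
    ; _≈_ = _≈_
    ; _+_ = _+ₚ_
    ; _*_ = _*ₚ_
    ; -_  = -ₚ_
    ; 0#  = λ _ → 0ℤ
    ; 1#  = zₚ^ 0
    ; isCommutativeRing = record
      { isRing = record
        { +-isAbelianGroup = record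
          { isGroup = record
            { isMonoid = record
              { isSemigroup = record
                { isMagma = record
                  { isEquivalence = record
                    { refl  = pointwise λ _ → ∼-refl
                    ; sym   = λ p → pointwise λ n → ∼-sym (at p n)
                    ; trans = λ p q → pointwise λ n → ∼-trans (at p n) (at q n)
                    }
                  ; ∙-cong = λ p q → pointwise λ n → ∼-+-cong (at p n) (at q n)
                  }
                ; assoc = λ f g h → ≗⇒≈ λ n → ℤ.+-assoc (f n) (g n) (h n)
                }
              ; identity = (λ f → ≗⇒≈ λ n → ℤ.+-identityˡ (f n))
                         , (λ f → ≗⇒≈ λ n → ℤ.+-identityʳ (f n))
              }
            ; inverse = (λ f → ≗⇒≈ λ n → ℤ.+-inverseˡ (f n))
                      , (λ f → ≗⇒≈ λ n → ℤ.+-inverseʳ (f n))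
            ; ⁻¹-cong = λ p → pointwise λ n → ∼-neg-cong (at p n)
            }
          ; comm = λ f g → ≗⇒≈ λ n → ℤ.+-comm (f n) (g n)
          }
        ; *-cong = λ p q → pointwise λ n →
            *ₚ-cong-≤ _ _ _ _ n (λ i _ → at p i) (λ i _ → at q i)
        ; *-assoc = λ f g h → ≗⇒≈ (*ₚ-assoc f g h)
        ; *-identity = (λ f → ≗⇒≈ (*ₚ-identityˡ f))
                     , (λ f → ≗⇒≈ λ n → trans (*ₚ-comm f (zₚ^ 0) n) (*ₚ-identityˡ f n))
        ; distrib = (λ f g h → ≗⇒≈ (*ₚ-distribˡ f g h))
                  , (λ f g h → ≗⇒≈ (*ₚ-distribʳ g h f))
        }
      ; *-comm = λ f g → ≗⇒≈ (*ₚ-comm f g)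
      }
    }

  κ-homo : ℤ.+-*-rawRing
             -Raw-AlmostCommutative⟶ fromCommutativeRing commutativeRing
  κ-homo = record
    { ⟦_⟧    = κ
    ; +-homo = λ a b → ≗⇒≈ λ where
        zero    → trans (κ-0 (a ℤ.+ b)) (sym (cong₂ ℤ._+_ (κ-0 a) (κ-0 b)))
        (suc n) → trans (κ-suc (a ℤ.+ b) n)
                    (sym (cong₂ ℤ._+_ (κ-suc a n) (κ-suc b n)))
    ; *-homo = λ a b → ≗⇒≈ λ where
        zero    → trans (κ-0 (a ℤ.* b))
                    (sym (trans (κ-* a (κ b) 0) (cong (a ℤ.*_) (κ-0 b))))
        (suc n) → trans (κ-suc (a ℤ.* b) n)
                    (sym (trans (κ-* a (κ b) (suc n))
                      (trans (cong (a ℤ.*_) (κ-suc b n)) (ℤ.*-zeroʳ a))))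
    ; -‿homo = λ a → ≗⇒≈ λ where
        zero    → trans (κ-0 (ℤ.- a)) (sym (cong ℤ.-_ (κ-0 a)))
        (suc n) → trans (κ-suc (ℤ.- a) n) (sym (cong ℤ.-_ (κ-suc a n)))
    ; 0-homo = ≗⇒≈ λ { zero → refl ; (suc _) → refl }
    ; 1-homo = ≗⇒≈ λ { zero → refl ; (suc _) → refl }
    }

  -- The lowest coefficient is f(0) g(0), and g(0) is prime to m, so m divides f(0). Removing f(0)
  -- g(k+1) from coefficient k + 1 leaves the same situation for `tail f`.
  *ₚ-cancelʳ-∣ : ∀ f g → Coprime (+ m) (g 0) →
    (∀ n → + m ∣ (f *ₚ g) n) → ∀ n → + m ∣ f n
  *ₚ-cancelʳ-∣ f g c p zero = ℤ.∣ᵤ⇒∣ (coprime-divisor (+ m) (g 0) (f 0) c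
    (ℤ.∣⇒∣ᵤ (subst (+ m ∣_)
      (trans (ℤ.+-identityʳ _) (ℤ.*-comm (f 0) (g 0))) (p 0))))
  *ₚ-cancelʳ-∣ f g c p (suc n) = *ₚ-cancelʳ-∣ (tail f) g c
    (λ k → ℤ.∣m+n∣m⇒∣n (p (suc k))
      (ℤ.∣m⇒∣m*n (g (suc k)) (*ₚ-cancelʳ-∣ f g c p 0))) n

  *ₚ-cancelʳ : ∀ f g c → Coprime (+ m) (c 0) →
    ((f +ₚ (-ₚ g)) *ₚ c) ≈ (λ _ → 0ℤ) → f ≈ g
  *ₚ-cancelʳ f g c coprime p = pointwise λ n → difference
    (*ₚ-cancelʳ-∣ (f +ₚ (-ₚ g)) c coprime (λ k → ∼0⇒∣ (at p k)) n)

  ⟨-z⟩-cong : ∀ {f g} → f ≈ g → (f ⟨-z⟩) ≈ (g ⟨-z⟩)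
  ⟨-z⟩-cong p = pointwise λ n → ∼-*-cong (∼-refl { -1ℤ ℤ.^ n}) (at p n)

  -- Laurent series modulo m

  -- Stricter than congruence of Laurent series, because the denominators must coincide as well; in
  -- return all operations respect it by congruence of the numerators alone.
  record _≃_ (a b : Laurent) : Set where
    constructor _,_
    field
      pole-≡   : Laurent.pole a ≡ Laurent.pole b
      series-≈ : Laurent.series a ≈ Laurent.series b

  open CommutativeRing commutativeRing
    using () renaming (refl to ≈-refl; trans to ≈-trans)

  ≃-refl : ∀ a → a ≃ a
  ≃-refl _ = refl , ≈-refl

  ≃-trans : ∀ {a b c} → a ≃ b → b ≃ c → a ≃ c
  ≃-trans (p , f) (q , g) = trans p q , ≈-trans f g

  -- Gives a compound expression an explicit denominator and leaves its numerator folded up, the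
  -- form in which `combination` takes its arguments.
  ≃-η : ∀ a {p} → Laurent.pole a ≡ p → a ≃ (z^-⟨ p ⟩· Laurent.series a)
  ≃-η a p = p , ≈-refl

  ≃-+-cong : ∀ {a b c d} → a ≃ b → c ≃ d → (a + c) ≃ (b + d)
  ≃-+-cong {z^-⟨ p ⟩· f} {z^-⟨ .p ⟩· f′} {z^-⟨ q ⟩· g} {z^-⟨ .q ⟩· g′}
    (refl , f≈) (refl , g≈) =
    refl , pointwise λ n → ∼-+-cong
      (*ₚ-cong-≤ (zₚ^ q) (zₚ^ q) f f′ n (λ _ _ → ∼-refl) (λ i _ → at f≈ i))
      (*ₚ-cong-≤ (zₚ^ p) (zₚ^ p) g g′ n (λ _ _ → ∼-refl) (λ i _ → at g≈ i))

  ≃-*-cong : ∀ {a b c d} → a ≃ b → c ≃ d → (a * c) ≃ (b * d)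
  ≃-*-cong {z^-⟨ p ⟩· f} {z^-⟨ .p ⟩· f′} {z^-⟨ q ⟩· g} {z^-⟨ .q ⟩· g′}
    (refl , f≈) (refl , g≈) =
    refl , pointwise λ n → *ₚ-cong-≤ f f′ g g′ n (λ i _ → at f≈ i) (λ i _ → at g≈ i)

  ≃-neg-cong : ∀ {a b} → a ≃ b → (- a) ≃ (- b)
  ≃-neg-cong (refl , f≈) = refl , pointwise λ n → ∼-neg-cong (at f≈ n)

  ≃-sub-cong : ∀ {a b c d} → a ≃ b → c ≃ d → (a - c) ≃ (b - d)
  ≃-sub-cong a≃b c≃d = ≃-+-cong a≃b (≃-neg-cong c≃d)

  ≃-shift⇒≡ : ∀ f a p → a ≃ (z^-⟨ p ⟩· (zₚ^ p *ₚ f)) → fromPS f ≡ a [mod m ]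
  ≃-shift⇒≡ f (z^-⟨ p ⟩· g) .p (refl , eq) (+ n) = _∼_.m∣a-b
    (subst₂ (λ i j → f i ∼ g j) (sym (ℕ.+-identityʳ n)) (ℕ.+-comm p n)
      (∼-trans (∼-reflexive (sym (zₚ-shift p f n))) (∼-sym (at eq (p ℕ.+ n)))))
  ≃-shift⇒≡ f (z^-⟨ p ⟩· g) .p (refl , eq) -[1+ n ] with p ℤ.⊖ suc n in p⊖1+n≡
  -- Here j = p - (n + 1) lies below p, where z^p f has no terms. In the last case the index is
  -- below both denominators and both coefficients are 0 by default.
  ... | + j      = _∼_.m∣a-b
    (∼-trans (∼-reflexive (sym (zₚ-*-below f j<p))) (∼-sym (at eq j)))
    where j<p = ℤ.drop‿+<+ (subst (ℤ._< + p) p⊖1+n≡ (ℤ.m⊖1+n<m p (suc n)))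
  ... | -[1+ _ ] = divides 0ℤ refl

-- Identities in commutative rings over ℤ

module Identities {c ℓ} (R : CommutativeRing c ℓ)
  (homo : ℤ.+-*-rawRing -Raw-AlmostCommutative⟶ fromCommutativeRing R) where

  open CommutativeRing R public
    using (Carrier; 0#; 1#)
    renaming (_≈_ to _≋_; _+_ to _⊕_; _*_ to _⊗_; _-_ to _⊝_; -_ to ⊝_)
  open CommutativeRing R
    using (setoid; +-cong; +-congˡ; +-congʳ; *-cong; *-congˡ; *-congʳ; *-assoc; -‿cong)
    renaming (refl to ≋-refl; sym to ≋-sym; trans to ≋-trans)
  open _-Raw-AlmostCommutative⟶_ homo public using () renaming (⟦_⟧ to κʳ)

  κʳ-≟ : WeaklyDecidable (Induced-equivalence homo)
  κʳ-≟ a b = Maybe.map (λ { refl → ≋-refl }) (dec⇒maybe (a ℤ.≟ b))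

  open RingSolver ℤ.+-*-rawRing (fromCommutativeRing R) homo κʳ-≟
    using (solve; con; _:=_; _:+_; _:*_; _:-_; :-_; _:^_)
  open import Relation.Binary.Reasoning.Setoid setoid

  -- One step of the telescoping, with x = z^(3^k): multiply the hypothesis by (1 + x)² and use (1 +
  -- x)³ = 1 + x³ + 3 (x + x²). The error is carried along explicitly as a multiple of 3.
  square-step : ∀ z x x³ p h → x ⊗ (x ⊗ x) ≋ x³ →
    (1# ⊕ z) ⊗ (p ⊗ p) ≋ (1# ⊕ x) ⊕ κʳ (+ 3) ⊗ h →
    (1# ⊕ z) ⊗ ((p ⊗ (1# ⊕ x)) ⊗ (p ⊗ (1# ⊕ x))) ≋
      (1# ⊕ x³) ⊕
      κʳ (+ 3) ⊗ (h ⊗ ((1# ⊕ x) ⊗ (1# ⊕ x)) ⊕ (x ⊕ x ⊗ x))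
  square-step z x x³ p h eq-x³ eq = begin
    (1# ⊕ z) ⊗ ((p ⊗ (1# ⊕ x)) ⊗ (p ⊗ (1# ⊕ x)))
      -- A zeroth power denotes `1#` itself, whereas `con (+ 1)` would denote `κʳ (+ 1)`.
      ≈⟨ solve 3 (λ z x p → let :1 = z :^ 0 in
           (:1 :+ z) :* ((p :* (:1 :+ x)) :* (p :* (:1 :+ x))) :=
           ((:1 :+ z) :* (p :* p)) :* ((:1 :+ x) :* (:1 :+ x)))
           ≋-refl z x p ⟩
    ((1# ⊕ z) ⊗ (p ⊗ p)) ⊗ ((1# ⊕ x) ⊗ (1# ⊕ x))
      ≈⟨ *-congʳ eq ⟩
    ((1# ⊕ x) ⊕ κʳ (+ 3) ⊗ h) ⊗ ((1# ⊕ x) ⊗ (1# ⊕ x))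
      ≈⟨ solve 2 (λ x h → let :1 = x :^ 0 in
           ((:1 :+ x) :+ con (+ 3) :* h) :* ((:1 :+ x) :* (:1 :+ x)) :=
           (:1 :+ x :* (x :* x)) :+
           con (+ 3) :* (h :* ((:1 :+ x) :* (:1 :+ x)) :+ (x :+ x :* x)))
           ≋-refl x h ⟩
    (1# ⊕ x ⊗ (x ⊗ x)) ⊕ κʳ (+ 3) ⊗ q
      ≈⟨ +-congʳ (+-congˡ eq-x³) ⟩
    (1# ⊕ x³) ⊕ κʳ (+ 3) ⊗ q ∎
    where q = h ⊗ ((1# ⊕ x) ⊗ (1# ⊕ x)) ⊕ (x ⊕ x ⊗ x)

  square-base : ∀ z →
    (1# ⊕ z) ⊗ (1# ⊗ 1#) ≋ (1# ⊕ z) ⊕ κʳ (+ 3) ⊗ 0#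
  square-base z = begin
    (1# ⊕ z) ⊗ (1# ⊗ 1#)
      ≈⟨ solve 1 (λ z → let :1 = z :^ 0 in
           (:1 :+ z) :* (:1 :* :1) := (:1 :+ z) :+ con (+ 3) :* con (+ 0))
           ≋-refl z ⟩
    (1# ⊕ z) ⊕ κʳ (+ 3) ⊗ κʳ (+ 0)
      ≈⟨ +-congˡ (*-congˡ (_-Raw-AlmostCommutative⟶_.0-homo homo)) ⟩
    (1# ⊕ z) ⊕ κʳ (+ 3) ⊗ 0# ∎

  -- x stands for z t′(z), so that (2 t − 1) x + z is z w′(z) for w = t² − t + z.
  quadratic-ODE : ∀ z t x →
    x ≋ κʳ (+ 4) ⊗ (z ⊗ x) ⊕ (z ⊝ κʳ (+ 2) ⊗ (z ⊗ t)) →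
    ((x ⊗ t ⊕ t ⊗ x) ⊝ x) ⊕ z ≋
      z ⊗ (κʳ (+ 4) ⊗ (((x ⊗ t ⊕ t ⊗ x) ⊝ x) ⊕ z) ⊝ κʳ (+ 4) ⊗ ((t ⊗ t ⊝ t) ⊕ z))
  quadratic-ODE z t x eq = begin
    ((x ⊗ t ⊕ t ⊗ x) ⊝ x) ⊕ z
      ≈⟨ solve 3 (λ z t x → ((x :* t :+ t :* x) :- x) :+ z :=
           (con (+ 2) :* t :- con (+ 1)) :* x :+ z) ≋-refl z t x ⟩
    (κʳ (+ 2) ⊗ t ⊝ κʳ (+ 1)) ⊗ x ⊕ z
      ≈⟨ +-congʳ (*-congˡ eq) ⟩
    (κʳ (+ 2) ⊗ t ⊝ κʳ (+ 1)) ⊗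
      (κʳ (+ 4) ⊗ (z ⊗ x) ⊕ (z ⊝ κʳ (+ 2) ⊗ (z ⊗ t))) ⊕ z
      -- The terms without x add up to z (1 - (2 t - 1)²) = -4 z (t² - t). On the right, the two
      -- contributions 4 z² cancel.
      ≈⟨ solve 3 (λ z t x →
           (con (+ 2) :* t :- con (+ 1)) :*
             (con (+ 4) :* (z :* x) :+ (z :- con (+ 2) :* (z :* t))) :+ z :=
           z :* (con (+ 4) :* (((x :* t :+ t :* x) :- x) :+ z) :-
             con (+ 4) :* ((t :* t :- t) :+ z)))
           ≋-refl z t x ⟩
    _ ∎

  -- z times the right-hand side of the theorem is −13 + odd-part z Ψ(−z); its
  -- coefficients appear here factored, 3 (z³ − 6 z² + 9 z − 4) as 3 (z − 4) (1 − z)².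
  odd-part : Carrier → Carrier → Carrier
  odd-part z p = p ⊗
    ((κʳ -[1+ 5 ] ⊗ (κʳ (+ 1) ⊕ κʳ (+ 2) ⊗ z) ⊕
      κʳ -[1+ 1 ] ⊗ ((κʳ (+ 4) ⊗ z ⊝ κʳ (+ 1)) ⊗ (z ⊕ κʳ (+ 2))) ⊗ (p ⊗ p)) ⊕
      κʳ (+ 3) ⊗ (z ⊝ κʳ (+ 4)) ⊗ (((1# ⊝ z) ⊗ (p ⊗ p)) ⊗ ((1# ⊝ z) ⊗ (p ⊗ p))))

  -- (1 - z) · `odd-part z p` divided by p, with w for (1 - z) p². A single factor 1 - z absorbs all
  -- even powers of p, since the coefficient of p⁵ already contains (1 - z)².
  reduced-odd-part : Carrier → Carrier → Carrier
  reduced-odd-part z w =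
    (κʳ -[1+ 5 ] ⊗ (κʳ (+ 1) ⊕ κʳ (+ 2) ⊗ z) ⊗ (1# ⊝ z) ⊕
     κʳ -[1+ 1 ] ⊗ ((κʳ (+ 4) ⊗ z ⊝ κʳ (+ 1)) ⊗ (z ⊕ κʳ (+ 2))) ⊗ w) ⊕
    κʳ (+ 3) ⊗ (z ⊝ κʳ (+ 4)) ⊗ (1# ⊝ z) ⊗ (w ⊗ w)

  odd-part-reduce : ∀ z p w → (1# ⊝ z) ⊗ (p ⊗ p) ≋ w →
    (1# ⊝ z) ⊗ odd-part z p ≋ p ⊗ reduced-odd-part z w
  odd-part-reduce z p w eq = begin
    (1# ⊝ z) ⊗ odd-part z p
      ≈⟨ solve 2 (λ z p →
           let d = z :^ 0 :- z
               a = con -[1+ 5 ] :* (con (+ 1) :+ con (+ 2) :* z)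
               b = con -[1+ 1 ] :* ((con (+ 4) :* z :- con (+ 1)) :* (z :+ con (+ 2)))
               c = con (+ 3) :* (z :- con (+ 4))
               w = d :* (p :* p) in
           d :* (p :* ((a :+ b :* (p :* p)) :+ c :* (w :* w))) :=
           p :* ((a :* d :+ b :* w) :+ c :* d :* (w :* w)))
           ≋-refl z p ⟩
    p ⊗ reduced-odd-part z ((1# ⊝ z) ⊗ (p ⊗ p))
      ≈⟨ *-congˡ (+-cong (+-congˡ (*-congˡ eq)) (*-congˡ (*-cong eq eq))) ⟩
    p ⊗ reduced-odd-part z w ∎

  -- z₂ and z₃ are the monomials that the sums of Laurent series put in front.
  numerator : ∀ z z₂ z₃ p c₁ c₃ c₅ p³ p⁵ → z₂ ≋ z ⊗ z → z₃ ≋ z ⊗ z₂ →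
    c₁ ≋ z ⊗ κʳ (+ 4) ⊕ κʳ (+ 2) →
    c₃ ≋ (⊝ κʳ (+ 8) ⊗ (z ⊗ z) ⊝ κʳ (+ 14) ⊗ z) ⊕ κʳ (+ 4) →
    c₅ ≋ ((z ⊗ (z ⊗ z) ⊝ κʳ (+ 6) ⊗ (z ⊗ z)) ⊕ κʳ (+ 9) ⊗ z) ⊝ κʳ (+ 4) →
    p³ ≋ p ⊗ (p ⊗ p) → p⁵ ≋ p ⊗ (p ⊗ (p ⊗ (p ⊗ p))) →
    z ⊗ (z ⊗ (z ⊗ (⊝ κʳ (+ 13) ⊗ 1#) ⊕ z ⊗ (⊝ (κʳ (+ 3) ⊗ c₁ ⊗ p))) ⊕ z₂ ⊗ (c₃ ⊗ p³)) ⊕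
    z₃ ⊗ (κʳ (+ 3) ⊗ c₅ ⊗ p⁵)
    ≋ z₃ ⊗ (κʳ -[1+ 12 ] ⊕ odd-part z p)
  numerator z z₂ z₃ p c₁ c₃ c₅ p³ p⁵ eq-z₂ eq-z₃ eq-c₁ eq-c₃ eq-c₅ eq-p³ eq-p⁵ = begin
    z ⊗ (z ⊗ (z ⊗ (⊝ κʳ (+ 13) ⊗ 1#) ⊕ z ⊗ (⊝ (κʳ (+ 3) ⊗ c₁ ⊗ p))) ⊕ z₂ ⊗ (c₃ ⊗ p³)) ⊕
      z₃ ⊗ (κʳ (+ 3) ⊗ c₅ ⊗ p⁵)
      ≈⟨ solve 9 (λ z z₂ z₃ p c₁ c₃ c₅ p³ p⁵ →
           z :* (z :* (z :* (:- con (+ 13) :* z :^ 0) :+ z :* (:- (con (+ 3) :* c₁ :* p))) :+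
             z₂ :* (c₃ :* p³)) :+ z₃ :* (con (+ 3) :* c₅ :* p⁵) :=
           ((z :* (z :* z)) :* (:- (con (+ 13) :+ con (+ 3) :* c₁ :* p)) :+
             (z :* z₂) :* (c₃ :* p³)) :+ z₃ :* (con (+ 3) :* c₅ :* p⁵))
           ≋-refl z z₂ z₃ p c₁ c₃ c₅ p³ p⁵ ⟩
    ((z ⊗ (z ⊗ z)) ⊗ (⊝ (κʳ (+ 13) ⊕ κʳ (+ 3) ⊗ c₁ ⊗ p)) ⊕ (z ⊗ z₂) ⊗ (c₃ ⊗ p³)) ⊕
      z₃ ⊗ (κʳ (+ 3) ⊗ c₅ ⊗ p⁵)
      -- In every summand the monomials have been gathered into z · (z · z), z · z₂ or z₃, all of
      -- which equal z₃.
      ≈⟨ +-cong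
           (+-cong
             (*-cong (≋-trans (*-congˡ (≋-sym eq-z₂)) (≋-sym eq-z₃))
                     (-‿cong (+-congˡ (*-congʳ (*-congˡ eq-c₁)))))
             (*-cong (≋-sym eq-z₃) (*-cong eq-c₃ eq-p³)))
           (*-congˡ (*-cong (*-congˡ eq-c₅) eq-p⁵)) ⟩
    (z₃ ⊗ (⊝ (κʳ (+ 13) ⊕ κʳ (+ 3) ⊗ (z ⊗ κʳ (+ 4) ⊕ κʳ (+ 2)) ⊗ p)) ⊕
      z₃ ⊗ (((⊝ κʳ (+ 8) ⊗ (z ⊗ z) ⊝ κʳ (+ 14) ⊗ z) ⊕ κʳ (+ 4)) ⊗ (p ⊗ (p ⊗ p)))) ⊕
      z₃ ⊗ (κʳ (+ 3) ⊗
        (((z ⊗ (z ⊗ z) ⊝ κʳ (+ 6) ⊗ (z ⊗ z)) ⊕ κʳ (+ 9) ⊗ z) ⊝ κʳ (+ 4)) ⊗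
        (p ⊗ (p ⊗ (p ⊗ (p ⊗ p)))))
      -- The factorisation used for the coefficient of p³ is -8 z² - 14 z + 4 = -2 (4 z - 1) (z +
      -- 2).
      ≈⟨ solve 3 (λ z z₃ p →
           let d = z :^ 0 :- z
               a = con -[1+ 5 ] :* (con (+ 1) :+ con (+ 2) :* z)
               b = con -[1+ 1 ] :* ((con (+ 4) :* z :- con (+ 1)) :* (z :+ con (+ 2)))
               c = con (+ 3) :* (z :- con (+ 4)) in
           (z₃ :* (:- (con (+ 13) :+ con (+ 3) :* (z :* con (+ 4) :+ con (+ 2)) :* p)) :+
             z₃ :* (((:- con (+ 8) :* (z :* z) :- con (+ 14) :* z) :+ con (+ 4)) :*
               (p :* (p :* p)))) :+
             z₃ :* (con (+ 3) :*
               (((z :* (z :* z) :- con (+ 6) :* (z :* z)) :+ con (+ 9) :* z) :- con (+ 4)) :*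
               (p :* (p :* (p :* (p :* p))))) :=
           z₃ :* (con -[1+ 12 ] :+
             p :* ((a :+ b :* (p :* p)) :+ c :* ((d :* (p :* p)) :* (d :* (p :* p))))))
           ≋-refl z z₃ p ⟩
    z₃ ⊗ (κʳ -[1+ 12 ] ⊕ odd-part z p) ∎

  -- From here to `p⁵-numerator` the left-hand sides are the numerators exactly as Laurent
  -- arithmetic produces them, over the denominator z for the three coefficients and over 1 for the
  -- two powers.
  c₁-numerator : ∀ z → z ⊗ κʳ (+ 4) ⊕ 1# ⊗ (κʳ (+ 2) ⊗ 1#) ≋ z ⊗ κʳ (+ 4) ⊕ κʳ (+ 2)
  c₁-numerator = solve 1 (λ z → let :1 = z :^ 0 in
    z :* con (+ 4) :+ :1 :* (con (+ 2) :* :1) := z :* con (+ 4) :+ con (+ 2)) ≋-refl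

  c₃-numerator : ∀ z →
    z ⊗ (1# ⊗ (⊝ κʳ (+ 8) ⊗ z) ⊕ 1# ⊗ (⊝ κʳ (+ 14))) ⊕ 1# ⊗ (κʳ (+ 4) ⊗ 1#) ≋
    (⊝ κʳ (+ 8) ⊗ (z ⊗ z) ⊝ κʳ (+ 14) ⊗ z) ⊕ κʳ (+ 4)
  c₃-numerator = solve 1 (λ z → let :1 = z :^ 0 in
    z :* (:1 :* (:- con (+ 8) :* z) :+ :1 :* (:- con (+ 14))) :+ :1 :* (con (+ 4) :* :1) :=
    (:- con (+ 8) :* (z :* z) :- con (+ 14) :* z) :+ con (+ 4)) ≋-refl

  c₅-numerator : ∀ z →
    z ⊗ (1# ⊗ (1# ⊗ (z ⊗ (z ⊗ κʳ (+ 1))) ⊕ 1# ⊗ (⊝ (κʳ (+ 6) ⊗ z))) ⊕ 1# ⊗ κʳ (+ 9)) ⊕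
      1# ⊗ (⊝ (κʳ (+ 4) ⊗ 1#)) ≋
    ((z ⊗ (z ⊗ z) ⊝ κʳ (+ 6) ⊗ (z ⊗ z)) ⊕ κʳ (+ 9) ⊗ z) ⊝ κʳ (+ 4)
  c₅-numerator = solve 1 (λ z → let :1 = z :^ 0 in
    z :* (:1 :* (:1 :* (z :* (z :* con (+ 1))) :+ :1 :* (:- (con (+ 6) :* z))) :+
      :1 :* con (+ 9)) :+ :1 :* (:- (con (+ 4) :* :1)) :=
    ((z :* (z :* z) :- con (+ 6) :* (z :* z)) :+ con (+ 9) :* z) :- con (+ 4)) ≋-refl

  p³-numerator : ∀ p → p ⊗ (p ⊗ (p ⊗ κʳ (+ 1))) ≋ p ⊗ (p ⊗ p)
  p³-numerator = solve 1 (λ p → p :* (p :* (p :* con (+ 1))) := p :* (p :* p)) ≋-refl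

  p⁵-numerator : ∀ p →
    p ⊗ (p ⊗ (p ⊗ (p ⊗ (p ⊗ κʳ (+ 1))))) ≋ p ⊗ (p ⊗ (p ⊗ (p ⊗ p)))
  p⁵-numerator = solve 1 (λ p →
    p :* (p :* (p :* (p :* (p :* con (+ 1))))) := p :* (p :* (p :* (p :* p)))) ≋-refl

  shifted-numerator : ∀ z z₃ z₄ g c → z₄ ≋ z₃ ⊗ z → g ≋ z ⊗ c → z₃ ⊗ g ≋ z₄ ⊗ c
  shifted-numerator z z₃ z₄ g c eq₄ eq-g = begin
    z₃ ⊗ g        ≈⟨ *-congˡ eq-g ⟩
    z₃ ⊗ (z ⊗ c)  ≈⟨ *-assoc z₃ z c ⟨
    z₃ ⊗ z ⊗ c    ≈⟨ *-congʳ eq₄ ⟨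
    z₄ ⊗ c        ∎

-- Identities that hold modulo 27

module Identities-mod-27 {c ℓ} (R : CommutativeRing c ℓ)
  (homo : ℤ.+-*-rawRing -Raw-AlmostCommutative⟶ fromCommutativeRing R)
  (κʳ-mod-27 : ∀ a b → + 27 ∣ a ℤ.- b →
    CommutativeRing._≈_ R (_-Raw-AlmostCommutative⟶_.⟦_⟧ homo a)
                          (_-Raw-AlmostCommutative⟶_.⟦_⟧ homo b)) where

  open Identities R homo
  open CommutativeRing R
    using (setoid; +-congˡ; +-congʳ; *-congˡ; *-congʳ; *-cong; +-cong; -‿cong)
    renaming (refl to ≋-refl)

  -- Coefficients are tested for zero modulo 27, so multiples of 27 vanish in the solver's normal
  -- forms; `reduced-quadratic` rests on this.
  κʳ-≟-mod-27 : WeaklyDecidable (Induced-equivalence homo)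
  κʳ-≟-mod-27 a b = Maybe.map (κʳ-mod-27 a b) (dec⇒maybe (+ 27 ℤ.∣? a ℤ.- b))

  open RingSolver ℤ.+-*-rawRing (fromCommutativeRing R) homo κʳ-≟-mod-27
    using (solve; con; _:=_; _:+_; _:*_; _:-_; _:^_)
  open import Relation.Binary.Reasoning.Setoid setoid

  -- 182 = 13² + 13 is the constant of g² − g + z for g = −13 + o.
  reduced-quadratic : ∀ z h → let w = κʳ (+ 1) ⊕ κʳ (+ 3) ⊗ h in
    (κʳ (+ 182) ⊕ z) ⊗ ((1# ⊝ z) ⊗ ((1# ⊝ z) ⊗ (1# ⊝ z))) ⊕
    w ⊗ (reduced-odd-part z w ⊗ reduced-odd-part z w) ≋ κʳ 0ℤ
  reduced-quadratic = solve 2 (λ z h →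
    let d = z :^ 0 :- z ; w = con (+ 1) :+ con (+ 3) :* h
        a = con -[1+ 5 ] :* (con (+ 1) :+ con (+ 2) :* z)
        b = con -[1+ 1 ] :* ((con (+ 4) :* z :- con (+ 1)) :* (z :+ con (+ 2)))
        c = con (+ 3) :* (z :- con (+ 4))
        r = (a :* d :+ b :* w) :+ c :* d :* (w :* w) in
    (con (+ 182) :+ z) :* (d :* (d :* d)) :+ w :* (r :* r) := con 0ℤ) ≋-refl

  -- Multiplying g ⊝ t by g ⊕ t ⊝ 1# gives (g² − g + z) − (t² − t + z).
  cofactor : Carrier → Carrier → Carrier → Carrier
  cofactor z t g = ((g ⊕ t) ⊝ 1#) ⊗ ((1# ⊝ z) ⊗ ((1# ⊝ z) ⊗ (1# ⊝ z)))

  -- Of the three factors 1 - z in the cofactor, two turn the square of the odd part into p² r², and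
  -- the third turns p² into 1 + 3 h. What remains is `reduced-quadratic`.
  quadratic : ∀ z p t g h →
    (1# ⊝ z) ⊗ (p ⊗ p) ≋ κʳ (+ 1) ⊕ κʳ (+ 3) ⊗ h →
    (t ⊗ t ⊝ t) ⊕ z ≋ 0# →
    g ≋ κʳ -[1+ 12 ] ⊕ odd-part z p →
    (g ⊝ t) ⊗ cofactor z t g ≋ 0#
  quadratic z p t g h eq-p eq-t eq-g = begin
    (g ⊝ t) ⊗ (((g ⊕ t) ⊝ 1#) ⊗ d³)
      ≈⟨ *-cong (+-congʳ eq-g) (*-congʳ (+-congʳ (+-congʳ eq-g))) ⟩
    ((κʳ -[1+ 12 ] ⊕ o) ⊝ t) ⊗ ((((κʳ -[1+ 12 ] ⊕ o) ⊕ t) ⊝ 1#) ⊗ d³)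
      -- In g² - g the linear term in o has the coefficient 2 · (-13) - 1 = -27 and disappears. Only
      -- o² is left, so p occurs in even powers only.
      ≈⟨ solve 3 (λ z o t → let :1 = z :^ 0 ; d = :1 :- z ; g = con -[1+ 12 ] :+ o in
           (g :- t) :* (((g :+ t) :- :1) :* (d :* (d :* d))) :=
           ((con (+ 182) :+ z) :* (d :* (d :* d)) :+ d :* ((d :* o) :* (d :* o))) :-
             (d :* (d :* d)) :* ((t :* t :- t) :+ z)) ≋-refl z o t ⟩
    ((κʳ (+ 182) ⊕ z) ⊗ d³ ⊕ d ⊗ ((d ⊗ o) ⊗ (d ⊗ o))) ⊝ d³ ⊗ ((t ⊗ t ⊝ t) ⊕ z)
      ≈⟨ +-cong (+-congˡ (*-congˡ (*-cong eq-o eq-o))) (-‿cong (*-congˡ eq-t)) ⟩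
    ((κʳ (+ 182) ⊕ z) ⊗ d³ ⊕ d ⊗ ((p ⊗ r) ⊗ (p ⊗ r))) ⊝ d³ ⊗ 0#
      ≈⟨ +-cong (+-congˡ (solve 3 (λ d p r → d :* ((p :* r) :* (p :* r)) :=
           (d :* (p :* p)) :* (r :* r)) ≋-refl d p r)) (-‿cong (zeroʳ d³)) ⟩
    ((κʳ (+ 182) ⊕ z) ⊗ d³ ⊕ (d ⊗ (p ⊗ p)) ⊗ (r ⊗ r)) ⊝ 0#
      ≈⟨ +-congʳ (+-congˡ (*-congʳ eq-p)) ⟩
    ((κʳ (+ 182) ⊕ z) ⊗ d³ ⊕ w ⊗ (r ⊗ r)) ⊝ 0#
      ≈⟨ +-congʳ (reduced-quadratic z h) ⟩
    κʳ 0ℤ ⊝ 0#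
      ≈⟨ +-congʳ (_-Raw-AlmostCommutative⟶_.0-homo homo) ⟩
    0# ⊝ 0#
      ≈⟨ -‿inverseʳ 0# ⟩
    0# ∎
    where
    open CommutativeRing R using (zeroʳ; -‿inverseʳ)
    d = 1# ⊝ z
    d³ = d ⊗ (d ⊗ d)
    w = κʳ (+ 1) ⊕ κʳ (+ 3) ⊗ h
    o = odd-part z p
    r = reduced-odd-part z w
    eq-o : d ⊗ o ≋ p ⊗ r
    eq-o = odd-part-reduce z p w eq-p

-- The substitution z ↦ -z in products

-- Taking tails shifts degrees by one, so `tail (f ⟨-z⟩)` is -1 times `tail f ⟨-z⟩`; this sign is
-- the one that degree n + 1 demands.
⟨-z⟩-* : ∀ f g n → ((f *ₚ g) ⟨-z⟩) n ≡ (f ⟨-z⟩ *ₚ g ⟨-z⟩) n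
⟨-z⟩-* f g zero = lemma (f 0) (g 0)
  where
  lemma : ∀ a b →
    1ℤ ℤ.* (a ℤ.* b ℤ.+ 0ℤ) ≡ (1ℤ ℤ.* a) ℤ.* (1ℤ ℤ.* b) ℤ.+ 0ℤ
  lemma = ℤ-Solver.solve-∀
⟨-z⟩-* f g (suc n) = sym (begin
  (1ℤ ℤ.* f 0) ℤ.* (-1ℤ ℤ.* s ℤ.* g (suc n)) ℤ.+
    (tail (f ⟨-z⟩) *ₚ g ⟨-z⟩) n
    ≡⟨ cong (ℤ._+_ ((1ℤ ℤ.* f 0) ℤ.* (-1ℤ ℤ.* s ℤ.* g (suc n))))
         (trans (*ₚ-congˡ (g ⟨-z⟩) (λ i → ℤ.*-assoc -1ℤ (-1ℤ ℤ.^ i) (f (suc i))) n)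
           (trans (*ₚ-scaleˡ -1ℤ (tail f ⟨-z⟩) (g ⟨-z⟩) n)
             (cong (-1ℤ ℤ.*_) (sym (⟨-z⟩-* (tail f) g n))))) ⟩
  (1ℤ ℤ.* f 0) ℤ.* (-1ℤ ℤ.* s ℤ.* g (suc n)) ℤ.+ -1ℤ ℤ.* (s ℤ.* (tail f *ₚ g) n)
    ≡⟨ lemma s (f 0) (g (suc n)) _ ⟩
  -1ℤ ℤ.* s ℤ.* (f 0 ℤ.* g (suc n) ℤ.+ (tail f *ₚ g) n) ∎)
  where
  open ≡-Reasoning
  s = -1ℤ ℤ.^ n
  lemma : ∀ s a b x → (1ℤ ℤ.* a) ℤ.* (-1ℤ ℤ.* s ℤ.* b) ℤ.+ -1ℤ ℤ.* (s ℤ.* x) ≡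
    -1ℤ ℤ.* s ℤ.* (a ℤ.* b ℤ.+ x)
  lemma = ℤ-Solver.solve-∀

-- The generating function of the Catalan numbers

-- Multiplied by (n + 1)! squared, both sides become (2 n + 2)!. The multiplier is written as (n +
-- 1)² (n!)² so that (n!)² can be matched with the formula for C_n.
catalan-suc : ∀ n → suc (suc n) ℕ.* catalan (suc n) ≡ 2 ℕ.* suc (2 ℕ.* n) ℕ.* catalan n
catalan-suc n = ℕ.*-cancelʳ-≡ _ _ (suc n ℕ.* suc n ℕ.* (n ! ℕ.* n !)) (begin
  suc (suc n) ℕ.* catalan (suc n) ℕ.* (suc n ℕ.* suc n ℕ.* (n ! ℕ.* n !))
    ≡⟨ cong (ℕ._* (suc n ℕ.* suc n ℕ.* (n ! ℕ.* n !))) (catalan-exact (suc n)) ⟩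
  ((2 ℕ.* suc n) C suc n) ℕ.* (suc n ℕ.* suc n ℕ.* (n ! ℕ.* n !))
    ≡⟨ lemma₁ ((2 ℕ.* suc n) C suc n) (suc n) (n !) ⟩
  ((2 ℕ.* suc n) C suc n) ℕ.* (suc n ! ℕ.* suc n !)
    ≡⟨ central-factorial (suc n) ⟩
  (2 ℕ.* suc n) !
    ≡⟨ cong _! (lemma₂ n) ⟩
  suc (suc (2 ℕ.* n)) ℕ.* (suc (2 ℕ.* n) ℕ.* (2 ℕ.* n) !)
    ≡⟨ cong (λ x → suc (suc (2 ℕ.* n)) ℕ.* (suc (2 ℕ.* n) ℕ.* x)) (begin
         (2 ℕ.* n) !                                 ≡⟨ central-factorial n ⟨
         ((2 ℕ.* n) C n) ℕ.* (n ! ℕ.* n !)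
           ≡⟨ cong (ℕ._* (n ! ℕ.* n !)) (catalan-exact n) ⟨
         suc n ℕ.* catalan n ℕ.* (n ! ℕ.* n !)       ∎) ⟩
  suc (suc (2 ℕ.* n)) ℕ.* (suc (2 ℕ.* n) ℕ.* (suc n ℕ.* catalan n ℕ.* (n ! ℕ.* n !)))
    ≡⟨ lemma₃ n (catalan n) (n ! ℕ.* n !) ⟩
  2 ℕ.* suc (2 ℕ.* n) ℕ.* catalan n ℕ.* (suc n ℕ.* suc n ℕ.* (n ! ℕ.* n !)) ∎)
  where
  open ≡-Reasoning
  instance
    _ = ℕ.m*n≢0 (suc n ℕ.* suc n) (n ! ℕ.* n !) {{_}} {{n !* n !≢0}}
  central-factorial : ∀ k → ((2 ℕ.* k) C k) ℕ.* (k ! ℕ.* k !) ≡ (2 ℕ.* k) !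
  central-factorial k = begin
    ((2 ℕ.* k) C k) ℕ.* (k ! ℕ.* k !)
      ≡⟨ cong (λ j → ((2 ℕ.* k) C k) ℕ.* (k ! ℕ.* j !)) 2k∸k≡k ⟨
    ((2 ℕ.* k) C k) ℕ.* (k ! ℕ.* (2 ℕ.* k ℕ.∸ k) !)
      ≡⟨ cong (ℕ._* (k ! ℕ.* (2 ℕ.* k ℕ.∸ k) !)) (nCk≡n!/k![n-k]! k≤2k) ⟩
    (2 ℕ.* k) ! / (k ! ℕ.* (2 ℕ.* k ℕ.∸ k) !) ℕ.* (k ! ℕ.* (2 ℕ.* k ℕ.∸ k) !)
      ≡⟨ m/n*n≡m (k![n∸k]!∣n! k≤2k) ⟩
    (2 ℕ.* k) ! ∎
    where
    instance
      _ = k !* (2 ℕ.* k ℕ.∸ k) !≢0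
    k≤2k : k ≤ 2 ℕ.* k
    k≤2k = ℕ.m≤m+n k (k ℕ.+ 0)
    2k∸k≡k : 2 ℕ.* k ℕ.∸ k ≡ k
    2k∸k≡k = trans (ℕ.m+n∸m≡n k (k ℕ.+ 0)) (ℕ.+-identityʳ k)
  lemma₁ : ∀ b s f → b ℕ.* (s ℕ.* s ℕ.* (f ℕ.* f)) ≡ b ℕ.* ((s ℕ.* f) ℕ.* (s ℕ.* f))
  lemma₁ = ℕ-Solver.solve-∀
  lemma₂ : ∀ n → 2 ℕ.* suc n ≡ suc (suc (2 ℕ.* n))
  lemma₂ = ℕ-Solver.solve-∀
  lemma₃ : ∀ n c f → suc (suc (2 ℕ.* n)) ℕ.* (suc (2 ℕ.* n) ℕ.* (suc n ℕ.* c ℕ.* f)) ≡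
    2 ℕ.* suc (2 ℕ.* n) ℕ.* c ℕ.* (suc n ℕ.* suc n ℕ.* f)
  lemma₃ = ℕ-Solver.solve-∀

-- The Euler operator z d/dz.
θ : PowerSeries → PowerSeries
θ f n = + n ℤ.* f n

-- The Leibniz rule, by induction through `tail (θ f)` = θ (`tail f`) + `tail f`.
θ-* : ∀ f g n → θ (f *ₚ g) n ≡ (θ f *ₚ g) n ℤ.+ (f *ₚ θ g) n
θ-* f g zero = lemma (f 0) (g 0)
  where
  lemma : ∀ a b → 0ℤ ℤ.* (a ℤ.* b ℤ.+ 0ℤ) ≡
    (0ℤ ℤ.* a ℤ.* b ℤ.+ 0ℤ) ℤ.+ (a ℤ.* (0ℤ ℤ.* b) ℤ.+ 0ℤ)
  lemma = ℤ-Solver.solve-∀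
θ-* f g (suc n) = begin
  + suc n ℤ.* (f 0 ℤ.* g (suc n) ℤ.+ (tail f *ₚ g) n)
    ≡⟨ lemma₁ (+ n) (f 0) (g (suc n)) _ ⟩
  + n ℤ.* (tail f *ₚ g) n ℤ.+ ((tail f *ₚ g) n ℤ.+ f 0 ℤ.* θ g (suc n))
    ≡⟨ cong (λ x → x ℤ.+ ((tail f *ₚ g) n ℤ.+ f 0 ℤ.* θ g (suc n))) (θ-* (tail f) g n) ⟩
  ((θ (tail f) *ₚ g) n ℤ.+ (tail f *ₚ θ g) n) ℤ.+
    ((tail f *ₚ g) n ℤ.+ f 0 ℤ.* θ g (suc n))
    ≡⟨ lemma₂ (f 0) (g (suc n)) ((θ (tail f) *ₚ g) n) ((tail f *ₚ θ g) n)
         ((tail f *ₚ g) n) (f 0 ℤ.* θ g (suc n)) ⟩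
  (0ℤ ℤ.* f 0 ℤ.* g (suc n) ℤ.+ ((θ (tail f) *ₚ g) n ℤ.+ (tail f *ₚ g) n)) ℤ.+
    (f 0 ℤ.* θ g (suc n) ℤ.+ (tail f *ₚ θ g) n)
    ≡⟨ cong (λ x → (0ℤ ℤ.* f 0 ℤ.* g (suc n) ℤ.+ x) ℤ.+
              (f 0 ℤ.* θ g (suc n) ℤ.+ (tail f *ₚ θ g) n))
         (trans (*ₚ-congˡ g (λ i → lemma₃ (+ i) (f (suc i))) n)
           (*ₚ-distribʳ (θ (tail f)) (tail f) g n)) ⟨
  (θ f *ₚ g) (suc n) ℤ.+ (f *ₚ θ g) (suc n) ∎
  where
  open ≡-Reasoning
  lemma₁ : ∀ k a b x → (1ℤ ℤ.+ k) ℤ.* (a ℤ.* b ℤ.+ x) ≡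
    k ℤ.* x ℤ.+ (x ℤ.+ a ℤ.* ((1ℤ ℤ.+ k) ℤ.* b))
  lemma₁ = ℤ-Solver.solve-∀
  lemma₂ : ∀ a b u v x y → (u ℤ.+ v) ℤ.+ (x ℤ.+ y) ≡
    (0ℤ ℤ.* a ℤ.* b ℤ.+ (u ℤ.+ x)) ℤ.+ (y ℤ.+ v)
  lemma₂ = ℤ-Solver.solve-∀
  lemma₃ : ∀ k a → (1ℤ ℤ.+ k) ℤ.* a ≡ k ℤ.* a ℤ.+ a
  lemma₃ = ℤ-Solver.solve-∀

θ-z : ∀ n → θ (zₚ^ 1) n ≡ (zₚ^ 1) n
θ-z zero          = refl
θ-z (suc zero)    = refl
θ-z (suc (suc n)) = ℤ.*-zeroʳ (+ suc (suc n))

catalanₚ : PowerSeries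
catalanₚ n = + catalan n

z·catalanₚ : PowerSeries
z·catalanₚ = zₚ^ 1 *ₚ catalanₚ

-- At z^(n+2) this is `catalan-suc` with 2 (2 n + 1) split as 4 (n + 1) - 2. The inhomogeneous term
-- z carries the initial value C_0 = 1.
catalan-ODE : ∀ n → θ z·catalanₚ n ≡
  (κ (+ 4) *ₚ (zₚ^ 1 *ₚ θ z·catalanₚ)) n ℤ.+
  ((zₚ^ 1) n ℤ.- (κ (+ 2) *ₚ (zₚ^ 1 *ₚ z·catalanₚ)) n)
catalan-ODE zero          = refl
catalan-ODE (suc zero)    = refl
catalan-ODE (suc (suc n)) = begin
  + suc (suc n) ℤ.* z·catalanₚ (suc (suc n))
    ≡⟨ cong (+ suc (suc n) ℤ.*_) (zₚ-shift 1 catalanₚ (suc n)) ⟩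
  + suc (suc n) ℤ.* + catalan (suc n)
    ≡⟨ ℤ.pos-* (suc (suc n)) (catalan (suc n)) ⟨
  + (suc (suc n) ℕ.* catalan (suc n))
    ≡⟨ cong +_ (catalan-suc n) ⟩
  + (2 ℕ.* suc (2 ℕ.* n) ℕ.* catalan n)
    ≡⟨ ℤ.pos-* (2 ℕ.* suc (2 ℕ.* n)) (catalan n) ⟩
  + (2 ℕ.* suc (2 ℕ.* n)) ℤ.* + catalan n
    ≡⟨ cong (ℤ._* + catalan n) (trans (ℤ.pos-* 2 (suc (2 ℕ.* n)))
         (cong (λ x → + 2 ℤ.* (1ℤ ℤ.+ x)) (ℤ.pos-* 2 n))) ⟩
  + 2 ℤ.* (1ℤ ℤ.+ + 2 ℤ.* + n) ℤ.* + catalan n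
    ≡⟨ lemma (+ n) (+ catalan n) ⟩
  + 4 ℤ.* ((1ℤ ℤ.+ + n) ℤ.* + catalan n) ℤ.+ (0ℤ ℤ.- + 2 ℤ.* + catalan n)
    ≡⟨ cong₂ (λ x y → + 4 ℤ.* (+ suc n ℤ.* x) ℤ.+ (0ℤ ℤ.- + 2 ℤ.* y))
         (zₚ-shift 1 catalanₚ n) (zₚ-shift 1 catalanₚ n) ⟨
  + 4 ℤ.* θ z·catalanₚ (suc n) ℤ.+ (0ℤ ℤ.- + 2 ℤ.* z·catalanₚ (suc n))
    ≡⟨ cong₂ (λ x y → + 4 ℤ.* x ℤ.+ (0ℤ ℤ.- + 2 ℤ.* y))
         (zₚ-shift 1 (θ z·catalanₚ) (suc n)) (zₚ-shift 1 z·catalanₚ (suc n)) ⟨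
  + 4 ℤ.* (zₚ^ 1 *ₚ θ z·catalanₚ) (suc (suc n)) ℤ.+
    (0ℤ ℤ.- + 2 ℤ.* (zₚ^ 1 *ₚ z·catalanₚ) (suc (suc n)))
    ≡⟨ cong₂ (λ x y → x ℤ.+ (0ℤ ℤ.- y))
         (κ-* (+ 4) (zₚ^ 1 *ₚ θ z·catalanₚ) (suc (suc n)))
         (κ-* (+ 2) (zₚ^ 1 *ₚ z·catalanₚ) (suc (suc n))) ⟨
  _ ∎
  where
  open ≡-Reasoning
  lemma : ∀ k c → + 2 ℤ.* (1ℤ ℤ.+ + 2 ℤ.* k) ℤ.* c ≡
    + 4 ℤ.* ((1ℤ ℤ.+ k) ℤ.* c) ℤ.+ (0ℤ ℤ.- + 2 ℤ.* c)
  lemma = ℤ-Solver.solve-∀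

∼0⇒≡ : ∀ {a b} → Mod._∼_ 0 a b → a ≡ b
∼0⇒≡ {a} {b} (Mod.difference p) = ℤ.i-j≡0⇒i≡j a b (ℤ.0∣⇒≡0 p)

-- The differential equation makes the coefficients of w = T² - T + z satisfy (n + 1) w(n+1) = 4 (n
-- - 1) w(n). As w(0) = 0, all of them vanish.
catalan-quadratic : ∀ n →
  ((z·catalanₚ *ₚ z·catalanₚ) n ℤ.- z·catalanₚ n) ℤ.+ (zₚ^ 1) n ≡ 0ℤ
catalan-quadratic = vanishes
  where
  -- The modulus 0 means working over ℤ, where the factor n + 1 can be cancelled; modulo 27 it may
  -- be a zero divisor.
  open Mod 0
  open Identities commutativeRing κ-homo
  t = z·catalanₚ
  w = ((t *ₚ t) +ₚ (-ₚ t)) +ₚ zₚ^ 1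
  x = ((θ t *ₚ t +ₚ t *ₚ θ t) +ₚ (-ₚ θ t)) +ₚ zₚ^ 1

  θw≡x : ∀ n → θ w n ≡ x n
  θw≡x n = trans (lemma (+ n) _ (t n) _)
    (cong₂ (λ a b → (a ℤ.- θ t n) ℤ.+ b) (θ-* t t n) (θ-z n))
    where
    lemma : ∀ k a b c → k ℤ.* ((a ℤ.- b) ℤ.+ c) ≡
      (k ℤ.* a ℤ.- k ℤ.* b) ℤ.+ k ℤ.* c
    lemma = ℤ-Solver.solve-∀

  y = (κ (+ 4) *ₚ x) +ₚ (-ₚ (κ (+ 4) *ₚ w))

  ODE : ∀ n → x (suc n) ≡ + 4 ℤ.* x n ℤ.- + 4 ℤ.* w n
  ODE n = trans
    (∼0⇒≡ (at (quadratic-ODE (zₚ^ 1) t (θ t) (≗⇒≈ catalan-ODE)) (suc n)))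
    (trans (zₚ-shift 1 y n)
      (cong₂ ℤ._-_ (κ-* (+ 4) x n) (κ-* (+ 4) w n)))

  vanishes : ∀ n → w n ≡ 0ℤ
  vanishes zero    = refl
  vanishes (suc n) = ℤ.*-cancelˡ-≡ (+ suc n) (w (suc n)) 0ℤ (begin
    + suc n ℤ.* w (suc n)
      ≡⟨ θw≡x (suc n) ⟩
    x (suc n)
      ≡⟨ ODE n ⟩
    + 4 ℤ.* x n ℤ.- + 4 ℤ.* w n
      ≡⟨ cong (λ a → + 4 ℤ.* a ℤ.- + 4 ℤ.* w n) (θw≡x n) ⟨
    + 4 ℤ.* (+ n ℤ.* w n) ℤ.- + 4 ℤ.* w n
      ≡⟨ cong (λ a → + 4 ℤ.* (+ n ℤ.* a) ℤ.- + 4 ℤ.* a) (vanishes n) ⟩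
    + 4 ℤ.* (+ n ℤ.* 0ℤ) ℤ.- 0ℤ
      ≡⟨ cong (λ a → + 4 ℤ.* a ℤ.- 0ℤ) (ℤ.*-zeroʳ (+ n)) ⟩
    0ℤ
      ≡⟨ ℤ.*-zeroʳ (+ suc n) ⟨
    + suc n ℤ.* 0ℤ ∎)
    where open ≡-Reasoning

-- Ψ modulo 3

open Mod 27

κ-∼ : ∀ a b → + 27 ∣ a ℤ.- b → κ a ≈ κ b
κ-∼ a b p = pointwise λ where
  zero    → subst₂ _∼_ (sym (κ-0 a)) (sym (κ-0 b)) (difference p)
  (suc n) → ∼-reflexive (trans (κ-suc a n) (sym (κ-suc b n)))

open Identities-mod-27 commutativeRing κ-homo κ-∼
open Identities commutativeRing κ-homo
open CommutativeRing commutativeRing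
  using (*-congˡ) renaming (trans to ≈-trans)

cube-monomial : ∀ d → (zₚ^ d *ₚ (zₚ^ d *ₚ zₚ^ d)) ≈ zₚ^ (3 ℕ.* d)
cube-monomial d = ≈-trans (*-congˡ {zₚ^ d} (≗⇒≈ (zₚ-* d d)))
  (≗⇒≈ λ n → trans (zₚ-* d (d ℕ.+ d) n)
    (cong (λ e → (zₚ^ (d ℕ.+ (d ℕ.+ e))) n) (sym (ℕ.+-identityʳ d))))

-- The integral series ((1 + z) Ψₖ² - 1 - z^(3^k)) / 3 for Ψₖ = `Ψ-partial k`, by the recursion of
-- `square-step`. Having it explicitly turns a congruence modulo 3 into an equation usable modulo
-- 27.
Ψ-partial-quotient : ℕ → PowerSeries
Ψ-partial-quotient zero    = λ _ → 0ℤ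
Ψ-partial-quotient (suc k) =
  (Ψ-partial-quotient k *ₚ ((zₚ^ 0 +ₚ x) *ₚ (zₚ^ 0 +ₚ x))) +ₚ (x +ₚ x *ₚ x)
  where x = zₚ^ (3 ℕ.^ k)

Ψ-partial-square : ∀ k → ((zₚ^ 0 +ₚ zₚ^ 1) *ₚ (Ψ-partial k *ₚ Ψ-partial k)) ≈
  (zₚ^ 0 +ₚ zₚ^ (3 ℕ.^ k)) +ₚ (κ (+ 3) *ₚ Ψ-partial-quotient k)
Ψ-partial-square zero    = square-base (zₚ^ 1)
Ψ-partial-square (suc k) =
  square-step (zₚ^ 1) (zₚ^ (3 ℕ.^ k)) (zₚ^ (3 ℕ.^ suc k)) (Ψ-partial k)
    (Ψ-partial-quotient k) (cube-monomial (3 ℕ.^ k)) (Ψ-partial-square k)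

n<3^n : ∀ n → n < 3 ℕ.^ n
n<3^n zero    = s≤s z≤n
n<3^n (suc n) = ℕ.≤-<-trans (n<3^n n)
  (ℕ.^-monoʳ-< 3 (s≤s (s≤s z≤n)) (ℕ.n<1+n n))

Ψ-quotient : PowerSeries
Ψ-quotient n = Ψ-partial-quotient n n

-- Coefficient n is compared with stage n of the product, which agrees with Ψ up to degree n and
-- whose extra term z^(3^n) lies above that degree.
Ψ-square : ((zₚ^ 0 +ₚ zₚ^ 1) *ₚ (Ψ *ₚ Ψ)) ≈ κ (+ 1) +ₚ (κ (+ 3) *ₚ Ψ-quotient)
Ψ-square = pointwise λ n → ∼-trans
  (*ₚ-cong-≤ 1+z 1+z (Ψ *ₚ Ψ) (Ψ-partial n *ₚ Ψ-partial n) n (λ _ _ → ∼-refl)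
    λ i i≤n → *ₚ-cong-≤ Ψ (Ψ-partial n) Ψ (Ψ-partial n) i
      (λ j j≤i → Ψ∼partial (ℕ.≤-trans j≤i i≤n))
      (λ j j≤i → Ψ∼partial (ℕ.≤-trans j≤i i≤n)))
  (∼-trans (at (Ψ-partial-square n) n) (∼-reflexive (cong₂ ℤ._+_
    (trans (cong (ℤ._+_ ((zₚ^ 0) n)) (zₚ-below (n<3^n n)))
      (trans (ℤ.+-identityʳ _) (one n)))
    -- Multiplication by the constant 3 acts coefficientwise, so just coefficient n of the quotient
    -- enters, where `Ψ-quotient` is stage n by definition.
    (trans (κ-* (+ 3) (Ψ-partial-quotient n) n) (sym (κ-* (+ 3) Ψ-quotient n))))))
  where
  1+z : PowerSeries
  1+z = zₚ^ 0 +ₚ zₚ^ 1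
  Ψ∼partial : ∀ {j n} → j ≤ n → Ψ j ∼ Ψ-partial n j
  Ψ∼partial j≤n = ∼-reflexive (sym (Ψ-limit j≤n))
  one : ∀ n → (zₚ^ 0) n ≡ κ (+ 1) n
  one zero    = refl
  one (suc _) = refl

⟨-z⟩-square : ∀ f h → ((zₚ^ 0 +ₚ zₚ^ 1) *ₚ (f *ₚ f)) ≈ κ (+ 1) +ₚ (κ (+ 3) *ₚ h) →
  ((zₚ^ 0 +ₚ (-ₚ zₚ^ 1)) *ₚ (f ⟨-z⟩ *ₚ f ⟨-z⟩)) ≈ κ (+ 1) +ₚ (κ (+ 3) *ₚ h ⟨-z⟩)
⟨-z⟩-square f h eq = pointwise λ n → ∼-trans
  (∼-reflexive (sym (lhs n))) (∼-trans (at (⟨-z⟩-cong eq) n) (∼-reflexive (rhs n)))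
  where
  open ≡-Reasoning
  1+z 1-z : PowerSeries
  1+z = zₚ^ 0 +ₚ zₚ^ 1
  1-z = zₚ^ 0 +ₚ (-ₚ zₚ^ 1)
  1+z⟨-z⟩ : ∀ n → (1+z ⟨-z⟩) n ≡ 1-z n
  1+z⟨-z⟩ zero          = refl
  1+z⟨-z⟩ (suc zero)    = refl
  1+z⟨-z⟩ (suc (suc n)) = ℤ.*-zeroʳ (-1ℤ ℤ.^ suc (suc n))
  one⟨-z⟩ : ∀ n → (κ (+ 1) ⟨-z⟩) n ≡ κ (+ 1) n
  one⟨-z⟩ zero    = refl
  one⟨-z⟩ (suc n) = ℤ.*-zeroʳ (-1ℤ ℤ.^ suc n)
  lemma : ∀ s a → s ℤ.* (+ 3 ℤ.* a) ≡ + 3 ℤ.* (s ℤ.* a)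
  lemma = ℤ-Solver.solve-∀
  lhs : ∀ n → ((1+z *ₚ (f *ₚ f)) ⟨-z⟩) n ≡ (1-z *ₚ (f ⟨-z⟩ *ₚ f ⟨-z⟩)) n
  lhs n = begin
    ((1+z *ₚ (f *ₚ f)) ⟨-z⟩) n            ≡⟨ ⟨-z⟩-* 1+z (f *ₚ f) n ⟩
    (1+z ⟨-z⟩ *ₚ (f *ₚ f) ⟨-z⟩) n         ≡⟨ *ₚ-congˡ ((f *ₚ f) ⟨-z⟩) 1+z⟨-z⟩ n ⟩
    -- Commuting there and back puts the square on the left, where `*ₚ-congˡ` can rewrite it.
    (1-z *ₚ (f *ₚ f) ⟨-z⟩) n              ≡⟨ *ₚ-comm 1-z ((f *ₚ f) ⟨-z⟩) n ⟩
    ((f *ₚ f) ⟨-z⟩ *ₚ 1-z) n              ≡⟨ *ₚ-congˡ 1-z (⟨-z⟩-* f f) n ⟩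
    ((f ⟨-z⟩ *ₚ f ⟨-z⟩) *ₚ 1-z) n         ≡⟨ *ₚ-comm (f ⟨-z⟩ *ₚ f ⟨-z⟩) 1-z n ⟩
    (1-z *ₚ (f ⟨-z⟩ *ₚ f ⟨-z⟩)) n         ∎
  rhs : ∀ n → ((κ (+ 1) +ₚ (κ (+ 3) *ₚ h)) ⟨-z⟩) n ≡ κ (+ 1) n ℤ.+ (κ (+ 3) *ₚ h ⟨-z⟩) n
  rhs n = trans (ℤ.*-distribˡ-+ (-1ℤ ℤ.^ n) (κ (+ 1) n) ((κ (+ 3) *ₚ h) n))
    (cong₂ ℤ._+_ (one⟨-z⟩ n) (begin
      -1ℤ ℤ.^ n ℤ.* (κ (+ 3) *ₚ h) n   ≡⟨ cong (-1ℤ ℤ.^ n ℤ.*_) (κ-* (+ 3) h n) ⟩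
      -1ℤ ℤ.^ n ℤ.* (+ 3 ℤ.* h n)      ≡⟨ lemma (-1ℤ ℤ.^ n) (h n) ⟩
      + 3 ℤ.* (-1ℤ ℤ.^ n ℤ.* h n)      ≡⟨ κ-* (+ 3) (h ⟨-z⟩) n ⟨
      (κ (+ 3) *ₚ h ⟨-z⟩) n            ∎))

-- Comparison of the two sides

z·rhs : PowerSeries
z·rhs = κ -[1+ 12 ] +ₚ odd-part (zₚ^ 1) (Ψ ⟨-z⟩)

-- The constant term of the cofactor is −28.
z·rhs≈z·catalanₚ : z·rhs ≈ z·catalanₚ
z·rhs≈z·catalanₚ = *ₚ-cancelʳ z·rhs z·catalanₚ (cofactor (zₚ^ 1) z·catalanₚ z·rhs)
  (from-yes (coprime? (+ 27) -[1+ 27 ]))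
  (quadratic (zₚ^ 1) (Ψ ⟨-z⟩) z·catalanₚ z·rhs (Ψ-quotient ⟨-z⟩)
    (⟨-z⟩-square Ψ Ψ-quotient Ψ-square) (≗⇒≈ catalan-quadratic) (≗⇒≈ λ _ → refl))

-- The numerators and powers are variables: deciding definitional equality with
-- the unfolded ones is exponential in the depth of the expression.
combination : ∀ c₁ c₃ c₅ p p³ p⁵ →
  c₁ ≈ _ → c₃ ≈ _ → c₅ ≈ _ → p³ ≈ _ → p⁵ ≈ _ →
  (- # 13 * z⁻¹ - # 3 * (z^-⟨ 1 ⟩· c₁) * fromPS p + (z^-⟨ 1 ⟩· c₃) * fromPS p³ +
    # 3 * (z^-⟨ 1 ⟩· c₅) * fromPS p⁵) ≃
  -- Addition multiplies denominators: four summands over z give z⁴, and the surplus z³ stays in the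
  -- numerator.
  (z^-⟨ 4 ⟩· (zₚ^ 3 *ₚ (κ -[1+ 12 ] +ₚ odd-part (zₚ^ 1) p)))
combination c₁ c₃ c₅ p p³ p⁵ eq-c₁ eq-c₃ eq-c₅ eq-p³ eq-p⁵ = refl ,
  numerator (zₚ^ 1) (zₚ^ 2) (zₚ^ 3) p c₁ c₃ c₅ p³ p⁵
    (≗⇒≈ λ n → sym (zₚ-* 1 1 n)) (≗⇒≈ λ n → sym (zₚ-* 1 2 n))
    eq-c₁ eq-c₃ eq-c₅ eq-p³ eq-p⁵

shifted-catalan : (z^-⟨ 4 ⟩· (zₚ^ 3 *ₚ z·rhs)) ≃ (z^-⟨ 4 ⟩· (zₚ^ 4 *ₚ catalanₚ))
shifted-catalan = refl , shifted-numerator (zₚ^ 1) (zₚ^ 3) (zₚ^ 4) z·rhs catalanₚ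
  (≗⇒≈ λ n → sym (zₚ-* 3 1 n)) z·rhs≈z·catalanₚ

theorem13p2 : ∑Cₙzⁿ ≡
    - # 13 * z⁻¹
    - # 3 * (# 4 + # 2 * z⁻¹) * Ψ[-z]
    + (- # 8 * z - # 14 + # 4 * z⁻¹) * Ψ[-z] ^ 3
    + # 3 * (z ^ 2 - # 6 * z + # 9 - # 4 * z⁻¹) * Ψ[-z] ^ 5
    [mod 27 ]
theorem13p2 =
  let
    c₁ = # 4 + # 2 * z⁻¹
    c₃ = - # 8 * z - # 14 + # 4 * z⁻¹
    c₅ = z ^ 2 - # 6 * z + # 9 - # 4 * z⁻¹
  in
  -- Over the denominator z⁴ the Catalan series has the numerator z⁴ `catalanₚ`. The first chain of
  -- congruences brings the right-hand side into the form that `combination` expects.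
  ≃-shift⇒≡ catalanₚ _ 4 (≃-trans
    (≃-+-cong
      (≃-+-cong
        (≃-sub-cong (≃-refl (- # 13 * z⁻¹))
          (≃-*-cong (≃-*-cong (≃-refl (# 3)) (≃-η c₁ refl)) (≃-refl Ψ[-z])))
        (≃-*-cong (≃-η c₃ refl) (≃-η (Ψ[-z] ^ 3) refl)))
      (≃-*-cong (≃-*-cong (≃-refl (# 3)) (≃-η c₅ refl)) (≃-η (Ψ[-z] ^ 5) refl)))
    (≃-trans
      (combination (Laurent.series c₁) (Laurent.series c₃) (Laurent.series c₅) (Ψ ⟨-z⟩)
        (Laurent.series (Ψ[-z] ^ 3)) (Laurent.series (Ψ[-z] ^ 5))
        (c₁-numerator (zₚ^ 1)) (c₃-numerator (zₚ^ 1)) (c₅-numerator (zₚ^ 1))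
        (p³-numerator (Ψ ⟨-z⟩)) (p⁵-numerator (Ψ ⟨-z⟩)))
      shifted-catalan))
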